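{- Let $n,\ell$ be positive integers and let $m$ be a non-negative integer. Then $s^*(n,\ell,m)=\tilde{s}(n,\ell,m)$.
   Context: $[n]=\{1,\dots,n\}$ and $2^{[n]}$ is the set of all subsets of $[n]$. Families $\mathcal{F}_1,\dots,\mathcal{F}_\ell\subset 2^{[n]}$ satisfy the $m$-overlapping property if for any distinct $k_1,k_2\in[\ell]$ and any $F_1\in\mathcal{F}_{k_1}$, $F_2\in\mathcal{F}_{k_2}$ one has $|F_1\cap F_2|\le m$. The number $s^*(n,\ell,m)$ is the maximum of $|\mathcal{F}_1|\cdots|\mathcal{F}_\ell|$ over all families $\mathcal{F}_1,\dots,\mathcal{F}_\ell\subset 2^{[n]}$ with the $m$-overlapping property. Let $H$ be the complete $(m+1)$-uniform hypergraph on vertex set $[n]$ (its edges are all $(m+1)$-element subsets of $[n]$). Given a coloring of the edges of $H$ into $\ell$ colors (each edge gets exactly one color in $[\ell]$; not all colors need be used), a monochromatic clique of color $i$ is a set $K\subset[n]$ all of whose $(m+1)$-element subsets have color $i$; in particular every set of at most $m$ vertices is a monochromatic clique in each color. Let $k_i$ be the number of monochromatic cliques of color $i$. The number $\tilde{s}(n,\ell,m)$ is the maximum of $k_1\cdots k_\ell$ over all such colorings. -}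

module Defs where

open import Data.Bool.Base using (Bool; true; false; T)
open import Data.Bool.Properties using (T?)
open import Data.Empty using (⊥; ⊥-elim)
open import Data.Fin.Base using (Fin; zero; suc)
import Data.Fin.Properties as Fin
open import Data.Fin.Subset using (Subset; inside; outside; _∩_; _⊆_; ∣_∣)
open import Data.Fin.Subset.Properties using (_⊆?_)
open import Data.List.Base
  using (List; []; _∷_; [_]; _++_; map; filter; filterᵇ; length; tabulate; allFin; cartesianProductWith)
open import Data.List.Extrema.Nat using (max; xs≤max; argmax-sel)
open import Data.List.Membership.Propositional using (_∈_; find)
open import Data.List.Membership.Propositional.Properties
  using (∈-++⁺ˡ; ∈-++⁺ʳ; ∈-map⁺; ∈-map⁻; ∈-filter⁺; ∈-filter⁻; ∈-allFin)
open import Data.List.Properties using (filter-≐; tabulate-cong)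
open import Data.List.Relation.Unary.All as All using ()
open import Data.List.Relation.Unary.Any as Any using (Any; here; there)
open import Data.List.Relation.Unary.Any.Properties using (cartesianProductWith⁺; map⁺)
open import Data.List.Relation.Unary.Unique.Propositional using (Unique)
import Data.List.Relation.Unary.Unique.Propositional.Properties as Unique
open import Data.List.Relation.Unary.AllPairs using ([]; _∷_)
open import Data.Nat.Base using (ℕ; zero; suc; _≤_; NonZero)
open import Data.Nat.ListAction using (product)
open import Data.Nat.Properties using (_≟_; _≤?_; n≤0⇒n≡0)
open import Data.Product.Base using (∃; _×_; _,_; proj₂)
open import Data.Sum.Base using (inj₁; inj₂)
open import Data.Vec.Base using ([]; _∷_)
import Data.Vec.Properties as Vec
open import Function.Base using (_∘_)
open import Function.Bundles using (mk⇔)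
open import Relation.Binary.PropositionalEquality
  using (_≡_; _≢_; _≗_; refl; sym; trans; cong; subst)
open import Relation.Nullary.Decidable
  using (Dec; yes; no; does; map′; ¬?; _→-dec_; recompute; does-⇔)
open import Relation.Unary using (Decidable)

private
  variable
    A : Set
    n ℓ m : ℕ

allSubsets : ∀ n → List (Subset n)
allSubsets zero    = [ [] ]
allSubsets (suc n) =
  map (outside ∷_) (allSubsets n) ++ map (inside ∷_) (allSubsets n)

∈-allSubsets : (p : Subset n) → p ∈ allSubsets n
∈-allSubsets []            = here refl
∈-allSubsets (outside ∷ p) = ∈-++⁺ˡ (∈-map⁺ (outside ∷_) (∈-allSubsets p))
∈-allSubsets (inside  ∷ p) = ∈-++⁺ʳ _ (∈-map⁺ (inside ∷_) (∈-allSubsets p))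

allSubsets-unique : ∀ n → Unique (allSubsets n)
allSubsets-unique zero    = All.[] ∷ []
allSubsets-unique (suc n) =
  Unique.++⁺ (Unique.map⁺ Vec.∷-injectiveʳ (allSubsets-unique n))
             (Unique.map⁺ Vec.∷-injectiveʳ (allSubsets-unique n))
             λ { (p∈ , q∈) → disjoint p∈ q∈ }
  where
  disjoint : ∀ {p} → p ∈ map (outside ∷_) (allSubsets n) →
             p ∈ map (inside ∷_) (allSubsets n) → ⊥
  disjoint p∈ q∈ with ∈-map⁻ _ p∈ | ∈-map⁻ _ q∈
  ... | _ , _ , refl | _ , _ , ()

allSubsets? : {P : Subset n → Set} → Decidable P → Dec (∀ p → P p)
allSubsets? P? = map′ (λ h p → All.lookup h (∈-allSubsets p))
                      (λ h → All.universal h _)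
                      (All.all? P? (allSubsets _))

-- A family 𝓕 ⊆ 2^[n], given by its characteristic function.
Family : ℕ → Set
Family n = Subset n → Bool

infix 4 _∈ᶠ_
_∈ᶠ_ : Subset n → Family n → Set
F ∈ᶠ 𝓕 = T (𝓕 F)

card : Family n → ℕ
card 𝓕 = length (filterᵇ 𝓕 (allSubsets _))

cardProduct : (Fin ℓ → Family n) → ℕ
cardProduct 𝓕 = product (tabulate (card ∘ 𝓕))

Overlapping : ℕ → (Fin ℓ → Family n) → Set
Overlapping m 𝓕 =
  ∀ k₁ k₂ → k₁ ≢ k₂ → ∀ F₁ F₂ → F₁ ∈ᶠ 𝓕 k₁ → F₂ ∈ᶠ 𝓕 k₂ → ∣ F₁ ∩ F₂ ∣ ≤ m

overlapping? : ∀ m → Decidable (Overlapping {ℓ} {n} m)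
overlapping? m 𝓕 =
  Fin.all? λ k₁ → Fin.all? λ k₂ → ¬? (k₁ Fin.≟ k₂) →-dec
    (allSubsets? λ F₁ → allSubsets? λ F₂ →
      T? (𝓕 k₁ F₁) →-dec (T? (𝓕 k₂ F₂) →-dec (∣ F₁ ∩ F₂ ∣ ≤? m)))

-- The edges of the complete (m+1)-uniform hypergraph on [n].
record Edge (n m : ℕ) : Set where
  constructor edge
  field
    vertices : Subset n
    .size    : ∣ vertices ∣ ≡ suc m

open Edge public

Colouring : (n ℓ m : ℕ) → Set
Colouring n ℓ m = Edge n m → Fin ℓ

IsMonochromaticClique : Colouring n ℓ m → Fin ℓ → Subset n → Set
IsMonochromaticClique c i K = ∀ e → vertices e ⊆ K → c e ≡ i

isMonochromaticClique? : (c : Colouring n ℓ m) (i : Fin ℓ) →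
                         Decidable (IsMonochromaticClique c i)
isMonochromaticClique? {m = m} c i K =
  map′ (λ { h (edge p ∣p∣≡) → h p (recompute (_ ≟ _) ∣p∣≡) })
       (λ h p ∣p∣≡ → h (edge p ∣p∣≡))
       (allSubsets? dec)
  where
  dec : ∀ p → Dec ((∣p∣≡ : ∣ p ∣ ≡ suc m) → p ⊆ K → c (edge p ∣p∣≡) ≡ i)
  dec p with ∣ p ∣ ≟ suc m
  ... | no  ∣p∣≢ = yes λ ∣p∣≡ → ⊥-elim (∣p∣≢ ∣p∣≡)
  ... | yes ∣p∣≡ = map′ (λ h _ → h) (λ h → h ∣p∣≡)
                        ((p ⊆? K) →-dec (c (edge p ∣p∣≡) Fin.≟ i))

cliques : Colouring n ℓ m → Fin ℓ → Family n
cliques c i K = does (isMonochromaticClique? c i K)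

-- The lists of functions below are exhaustive up to pointwise equality only.

caseSide : (Subset n → A) → (Subset n → A) → Subset (suc n) → A
caseSide f g (outside ∷ p) = f p
caseSide f g (inside  ∷ p) = g p

functionsOnSubsets : List A → ∀ n → List (Subset n → A)
functionsOnSubsets as zero    = map (λ a _ → a) as
functionsOnSubsets as (suc n) =
  cartesianProductWith caseSide (functionsOnSubsets as n) (functionsOnSubsets as n)

functionsOnSubsets-complete :
  ∀ {as : List A} → (∀ a → a ∈ as) →
  (f : Subset n → A) → Any (f ≗_) (functionsOnSubsets as n)
functionsOnSubsets-complete {n = zero} all f =
  map⁺ (Any.map (λ { eq [] → eq }) (all (f [])))
functionsOnSubsets-complete {n = suc n} all f =
  cartesianProductWith⁺ caseSide
    (λ { eq₁ eq₂ (outside ∷ p) → eq₁ p ; eq₁ eq₂ (inside ∷ p) → eq₂ p })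
    (functionsOnSubsets-complete all (f ∘ (outside ∷_)))
    (functionsOnSubsets-complete all (f ∘ (inside ∷_)))

allFamilies : ∀ n → List (Family n)
allFamilies = functionsOnSubsets (false ∷ true ∷ [])

allFamilies-complete : (𝓕 : Family n) → Any (𝓕 ≗_) (allFamilies n)
allFamilies-complete =
  functionsOnSubsets-complete λ { false → here refl ; true → there (here refl) }

consTuple : A → (Fin ℓ → A) → Fin (suc ℓ) → A
consTuple a f zero    = a
consTuple a f (suc i) = f i

tuples : List A → ∀ ℓ → List (Fin ℓ → A)
tuples as zero    = [ (λ ()) ]
tuples as (suc ℓ) = cartesianProductWith consTuple as (tuples as ℓ)

tuples-complete :
  ∀ {as : List A} {_≈_ : A → A → Set} → (∀ a → Any (a ≈_) as) →
  (f : Fin ℓ → A) → Any (λ g → ∀ i → f i ≈ g i) (tuples as ℓ)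
tuples-complete {ℓ = zero}  all f = here λ ()
tuples-complete {ℓ = suc ℓ} all f =
  cartesianProductWith⁺ consTuple (λ { eq eqs zero → eq ; eq eqs (suc i) → eqs i })
    (all (f zero)) (tuples-complete all (f ∘ suc))

allColourings : ∀ n ℓ m → List (Colouring n ℓ m)
allColourings n ℓ m = map (_∘ vertices) (functionsOnSubsets (allFin ℓ) n)

allColourings-complete :
  .{{NonZero ℓ}} → (c : Colouring n ℓ m) → Any (c ≗_) (allColourings n ℓ m)
allColourings-complete {ℓ = suc ℓ} {n} {m} c =
  map⁺ (Any.map (λ eq e → trans (sym (extend-vertices e)) (eq (vertices e)))
                (functionsOnSubsets-complete ∈-allFin extend))
  where
  extend : Subset n → Fin (suc ℓ)
  extend p with ∣ p ∣ ≟ suc m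
  ... | yes ∣p∣≡ = c (edge p ∣p∣≡)
  ... | no  _    = zero

  extend-vertices : ∀ e → extend (vertices e) ≡ c e
  extend-vertices (edge p ∣p∣≡) with ∣ p ∣ ≟ suc m
  ... | yes _    = refl
  ... | no ∣p∣≢ = ⊥-elim (∣p∣≢ (recompute (_ ≟ _) ∣p∣≡))

s* : (n ℓ m : ℕ) → ℕ
s* n ℓ m =
  max 0 (map cardProduct (filter (overlapping? m) (tuples (allFamilies n) ℓ)))

s̃ : (n ℓ m : ℕ) → ℕ
s̃ n ℓ m = max 0 (map (cardProduct ∘ cliques) (allColourings n ℓ m))

-- The lemmas s*-isMaximum and s̃-isMaximum below show that the default 0 and
-- the enumerations used above play no role: these are the maxima over all
-- families and over all colourings.

record IsMaximum (V : ℕ → Set) (k : ℕ) : Set where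
  field
    attained : V k
    bound    : ∀ {j} → V j → j ≤ k

max-isMaximum : ∀ {V : ℕ → Set} {xs} → (∀ {j} → V j → j ∈ xs) →
                (∀ {j} → j ∈ xs → V j) → ∃ V → IsMaximum V (max 0 xs)
max-isMaximum {V} {xs} to from (j , Vj) = record
  { attained = attained
  ; bound    = bound
  }
  where
  bound : ∀ {j} → V j → j ≤ max 0 xs
  bound Vj = All.lookup (xs≤max 0 xs) (to Vj)

  attained : V (max 0 xs)
  attained with argmax-sel (λ x → x) 0 xs
  ... | inj₂ max∈ = from max∈
  ... | inj₁ max≡0 =
    subst V (trans (n≤0⇒n≡0 (subst (j ≤_) max≡0 (bound Vj))) (sym max≡0)) Vj

cardProduct-cong : {𝓕 𝓖 : Fin ℓ → Family n} → (∀ k → 𝓕 k ≗ 𝓖 k) →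
                   cardProduct 𝓕 ≡ cardProduct 𝓖
cardProduct-cong eq = cong product (tabulate-cong λ k →
  cong length (filter-≐ (T? ∘ _) (T? ∘ _)
    ((λ {F} → subst T (eq k F)) , (λ {F} → subst T (sym (eq k F)))) (allSubsets _)))

cliques-cong : {c d : Colouring n ℓ m} → c ≗ d → ∀ i → cliques c i ≗ cliques d i
cliques-cong {c = c} {d} eq i K =
  does-⇔ (mk⇔ (λ h e e⊆K → trans (sym (eq e)) (h e e⊆K))
              (λ h e e⊆K → trans (eq e) (h e e⊆K)))
         (isMonochromaticClique? c i K) (isMonochromaticClique? d i K)

OverlappingProduct : (n ℓ m : ℕ) → ℕ → Set
OverlappingProduct n ℓ m j =
  ∃ λ (𝓕 : Fin ℓ → Family n) → Overlapping m 𝓕 × cardProduct 𝓕 ≡ j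

CliqueProduct : (n ℓ m : ℕ) → ℕ → Set
CliqueProduct n ℓ m j =
  ∃ λ (c : Colouring n ℓ m) → cardProduct (cliques c) ≡ j

s*-isMaximum : ∀ n ℓ m → IsMaximum (OverlappingProduct n ℓ m) (s* n ℓ m)
s*-isMaximum n ℓ m =
  max-isMaximum to from (_ , (λ _ _ → false) , (λ _ _ _ _ _ ()) , refl)
  where
  candidates : List (Fin ℓ → Family n)
  candidates = tuples (allFamilies n) ℓ

  values : List ℕ
  values = map cardProduct (filter (overlapping? m) candidates)

  to : ∀ {j} → OverlappingProduct n ℓ m j → j ∈ values
  to (𝓕 , ov , refl)
    with 𝓖 , 𝓖∈ , eq ← find (tuples-complete {_≈_ = _≗_} allFamilies-complete 𝓕)
    = subst (_∈ values) (sym (cardProduct-cong eq))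
        (∈-map⁺ cardProduct (∈-filter⁺ (overlapping? m) 𝓖∈
          λ k₁ k₂ k₁≢k₂ F₁ F₂ F₁∈ F₂∈ → ov k₁ k₂ k₁≢k₂ F₁ F₂
            (subst T (sym (eq k₁ F₁)) F₁∈) (subst T (sym (eq k₂ F₂)) F₂∈)))

  from : ∀ {j} → j ∈ values → OverlappingProduct n ℓ m j
  from j∈ with 𝓕 , 𝓕∈ , j≡ ← ∈-map⁻ cardProduct j∈ =
    𝓕 , proj₂ (∈-filter⁻ (overlapping? m) {xs = candidates} 𝓕∈) , sym j≡

s̃-isMaximum : ∀ n ℓ m → .{{NonZero ℓ}} → IsMaximum (CliqueProduct n ℓ m) (s̃ n ℓ m)
s̃-isMaximum n ℓ@(suc _) m = max-isMaximum to from (_ , (λ _ → zero) , refl)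
  where
  values : List ℕ
  values = map (cardProduct ∘ cliques) (allColourings n ℓ m)

  to : ∀ {j} → CliqueProduct n ℓ m j → j ∈ values
  to (c , refl) with d , d∈ , eq ← find (allColourings-complete c) =
    subst (_∈ values) (sym (cardProduct-cong (cliques-cong eq)))
      (∈-map⁺ (cardProduct ∘ cliques) d∈)

  from : ∀ {j} → j ∈ values → CliqueProduct n ℓ m j
  from j∈ with c , _ , j≡ ← ∈-map⁻ (cardProduct ∘ cliques) j∈ = c , sym j≡

{-# OPTIONS --safe #-}
module Submission where

-- The colour classes of cliques overlap in at most m points, since a larger
-- intersection contains an edge of two colours. Conversely, given overlapping
-- families, each edge lies in members of at most one 𝓕ₖ; colouring it with that
-- k makes every member of 𝓕ₖ a clique of colour k.

open import Defs
open import Data.Bool.Base using (T)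
open import Data.Bool.Properties using (T?)
open import Data.Fin.Base using (Fin; zero)
import Data.Fin.Properties as Fin
open import Data.Fin.Subset using (Subset; inside; outside; ⊥; _∩_; _⊆_; ∣_∣)
open import Data.Fin.Subset.Properties
  using (anySubset?; _⊆?_; ⊥⊆; ∣⊥∣≡0; in⊆in; out⊆; ⊆-trans; p⊆q⇒∣p∣≤∣q∣;
         p∩q⊆p; p∩q⊆q; x∈p∩q⁺)
open import Data.List.Relation.Binary.Pointwise using (foldr⁺; tabulate⁺)
open import Data.List.Relation.Binary.Sublist.Propositional using (⊆-refl)
open import Data.List.Relation.Binary.Sublist.Propositional.Properties
  using (filter⁺; length-mono-≤)
open import Data.Nat.Base using (ℕ; zero; suc; _≤_; _<_; s≤s; NonZero)
open import Data.Nat.Properties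
  using (_≟_; *-mono-≤; ≤-refl; ≤-trans; ≤-antisym; ≤-reflexive; ≮⇒≥; <⇒≱)
open import Data.Product.Base using (∃; _×_; _,_)
open import Data.Vec.Base using ([]; _∷_)
open import Relation.Binary.PropositionalEquality using (_≡_; refl; sym; trans; cong)
open import Relation.Nullary.Decidable
  using (Dec; does; yes; no; _×-dec_; recompute; decidable-stable)
open import Relation.Nullary.Negation using (contradiction)

private
  variable
    n ℓ m : ℕ

-- Greedy: the first `k` elements of `p` are kept. This extracts an edge from a large intersection.
subsetOfSize : ∀ {k} (p : Subset n) → k ≤ ∣ p ∣ → ∃ λ q → q ⊆ p × ∣ q ∣ ≡ k
subsetOfSize {n} {zero}  p             _        = ⊥ , ⊥⊆ , ∣⊥∣≡0 n
subsetOfSize {_} {suc k} (outside ∷ p) k≤       =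
  let q , q⊆p , ∣q∣≡ = subsetOfSize p k≤ in outside ∷ q , out⊆ q⊆p , ∣q∣≡
subsetOfSize {_} {suc k} (inside ∷ p)  (s≤s k≤) =
  let q , q⊆p , ∣q∣≡ = subsetOfSize p k≤ in inside ∷ q , in⊆in q⊆p , cong suc ∣q∣≡

card-mono : {𝓕 𝓖 : Family n} → (∀ F → F ∈ᶠ 𝓕 → F ∈ᶠ 𝓖) → card 𝓕 ≤ card 𝓖
card-mono {𝓕 = 𝓕} {𝓖} 𝓕⊆𝓖 =
  length-mono-≤ (filter⁺ (λ F → T? (𝓕 F)) (λ F → T? (𝓖 F)) (λ { refl → 𝓕⊆𝓖 _ })
    (⊆-refl {x = allSubsets _}))

cardProduct-mono : {𝓕 𝓖 : Fin ℓ → Family n} →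
                   (∀ k F → F ∈ᶠ 𝓕 k → F ∈ᶠ 𝓖 k) → cardProduct 𝓕 ≤ cardProduct 𝓖
cardProduct-mono 𝓕⊆𝓖 = foldr⁺ {R = _≤_} *-mono-≤ ≤-refl (tabulate⁺ λ k → card-mono (𝓕⊆𝓖 k))

T-does⁺ : {A : Set} (a? : Dec A) → A → T (does a?)
T-does⁺ (yes _) _ = _
T-does⁺ (no ¬a) a = contradiction a ¬a

T-does⁻ : {A : Set} (a? : Dec A) → T (does a?) → A
T-does⁻ (yes a) _ = a

∈-cliques⁺ : (c : Colouring n ℓ m) → ∀ i K → IsMonochromaticClique c i K → K ∈ᶠ cliques c i
∈-cliques⁺ c i K = T-does⁺ (isMonochromaticClique? c i K)

∈-cliques⁻ : (c : Colouring n ℓ m) → ∀ i K → K ∈ᶠ cliques c i → IsMonochromaticClique c i K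
∈-cliques⁻ c i K = T-does⁻ (isMonochromaticClique? c i K)

cliques-overlapping : (c : Colouring n ℓ m) → Overlapping m (cliques c)
cliques-overlapping c i j i≢j K L K∈ L∈ = ≮⇒≥ λ m<∣K∩L∣ →
  -- `m < ∣ K ∩ L ∣` unfolds to `suc m ≤ ∣ K ∩ L ∣`, and `suc m` is exactly the size of an edge.
  let p , p⊆K∩L , ∣p∣≡ = subsetOfSize (K ∩ L) m<∣K∩L∣
      e                = edge p ∣p∣≡
  in i≢j (trans
       (sym (∈-cliques⁻ c i K K∈ e (⊆-trans p⊆K∩L (p∩q⊆p K L))))
       (∈-cliques⁻ c j L L∈ e (⊆-trans p⊆K∩L (p∩q⊆q K L))))

edge⊆both⇒m<∣∩∣ : (e : Edge n m) (p q : Subset n) →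
                  vertices e ⊆ p → vertices e ⊆ q → m < ∣ p ∩ q ∣
edge⊆both⇒m<∣∩∣ (edge r ∣r∣≡) p q r⊆p r⊆q =
  -- The size proof stored in an edge is irrelevant; decidable equality on `ℕ` recovers a usable
  -- one.
  ≤-trans (≤-reflexive (sym (recompute (_ ≟ _) ∣r∣≡)))
          (p⊆q⇒∣p∣≤∣q∣ λ x∈r → x∈p∩q⁺ (r⊆p x∈r , r⊆q x∈r))

Covers : (Fin ℓ → Family n) → Edge n m → Fin ℓ → Set
Covers 𝓕 e k = ∃ λ F → F ∈ᶠ 𝓕 k × vertices e ⊆ F

-- A finite search over colours and subsets, which allows a colouring to be defined by cases on its
-- outcome.
covered? : (𝓕 : Fin ℓ → Family n) (e : Edge n m) → Dec (∃ (Covers 𝓕 e))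
covered? 𝓕 e = Fin.any? λ k → anySubset? λ F → T? (𝓕 k F) ×-dec (vertices e ⊆? F)

coveringColour : (𝓕 : Fin (suc ℓ) → Family n) → Colouring n (suc ℓ) m
coveringColour 𝓕 e with covered? 𝓕 e
... | yes (k , _) = k
-- An edge inside no member of any family may take any colour; `suc ℓ` ensures that one exists.
... | no  _       = zero

coveringColour-unique : (𝓕 : Fin (suc ℓ) → Family n) → Overlapping m 𝓕 →
                        ∀ (e : Edge n m) k → Covers 𝓕 e k → coveringColour 𝓕 e ≡ k
coveringColour-unique 𝓕 ov e k (F , F∈ , e⊆F) with covered? 𝓕 e
... | no ¬covered = contradiction (k , F , F∈ , λ {x} → e⊆F {x}) ¬covered
-- The search may find a colour `j` other than `k`; then `G` and `F` share all `suc m` vertices of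
-- `e`, against the overlap bound.
... | yes (j , G , G∈ , e⊆G) = decidable-stable (j Fin.≟ k) λ j≢k →
  <⇒≱ (edge⊆both⇒m<∣∩∣ e G F e⊆G e⊆F) (ov j k j≢k G F G∈ F∈)

-- Only an inclusion: the colouring may have further cliques, but these can only raise the product.
overlapping⊆cliques : (𝓕 : Fin (suc ℓ) → Family n) → Overlapping m 𝓕 →
                      ∀ k F → F ∈ᶠ 𝓕 k → F ∈ᶠ cliques {m = m} (coveringColour 𝓕) k
overlapping⊆cliques 𝓕 ov k F F∈ =
  ∈-cliques⁺ (coveringColour 𝓕) k F λ e e⊆F →
    coveringColour-unique 𝓕 ov e k (F , F∈ , λ {x} → e⊆F {x})

proposition4 : (n ℓ m : ℕ) → .{{_ : NonZero n}} → .{{_ : NonZero ℓ}} → s* n ℓ m ≡ s̃ n ℓ m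
proposition4 n ℓ@(suc _) m = ≤-antisym s*≤s̃ s̃≤s*
  where
  module S* = IsMaximum (s*-isMaximum n ℓ m)
  module S̃  = IsMaximum (s̃-isMaximum n ℓ m)

  s*≤s̃ : s* n ℓ m ≤ s̃ n ℓ m
  s*≤s̃ with 𝓕 , ov , ∏≡ ← S*.attained =
    ≤-trans (≤-reflexive (sym ∏≡))
      (≤-trans (cardProduct-mono (overlapping⊆cliques 𝓕 ov)) (S̃.bound (coveringColour 𝓕 , refl)))

  s̃≤s* : s̃ n ℓ m ≤ s* n ℓ m
  -- The clique families of an optimal colouring compete for `s*` with the same product.
  s̃≤s* with c , ∏≡ ← S̃.attained = S*.bound (cliques c , cliques-overlapping c , ∏≡)
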